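{- Let $f,g:\mathbb{N}\to\mathbb{N}$ be functions with $n=o(f(n))$ and $g(n)=o(n^{2})$ as $n\to\infty$, and let $l:\mathbb{N}\to\mathbb{N}$ satisfy $f(n)\le l(n)\le g(n)$ for every $n\in\mathbb{N}$. Then $$r(l(n))\sim \frac{l(n)^{2}}{2\alpha_n}\qquad (n\to\infty).$$
   Context: For $n\in\mathbb{N}$ let $G_n=G(n,3,1)$ be the graph whose vertex set $V_n$ consists of all $3$-element subsets of $\{1,\dots,n\}$ (equivalently, $(0,1)$-vectors in $\mathbb{R}^n$ with exactly three ones), two vertices being adjacent if and only if the corresponding sets share exactly one element (equivalently, the vectors have scalar product $1$). Let $\alpha_n$ denote the independence number of $G(n,3,1)$. For $W\subseteq V_n$ let $r(W)$ be the number of edges of $G(n,3,1)$ with both endpoints in $W$, and for an integer $0\le l\le \binom{n}{3}$ let $r(l)=\min\{r(W): W\subseteq V_n,\ |W|=l\}$ (so $r(l(n))$ is computed in $G(n,3,1)$). -}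

module Defs where

open import Data.Nat as ℕ using (ℕ; zero; suc)
open import Data.Nat.Properties using () renaming (_≟_ to _≟ℕ_)
open import Data.Integer using (+_)
open import Data.Rational using (ℚ; 0ℚ; _/_; _-_; _*_; _≤_; _<_; ∣_∣)
open import Data.Fin.Subset using (Subset; inside; outside; _∩_) renaming (∣_∣ to card)
open import Data.Vec using ([]; _∷_)
open import Data.List using (List; []; _∷_; [_]; _++_; map; filter; length)
open import Data.List.Extrema.Nat using (min; max)
open import Data.List.Relation.Unary.AllPairs using (AllPairs; allPairs?)
open import Data.Product using (∃-syntax)
open import Relation.Binary.PropositionalEquality using (_≡_)
open import Relation.Nullary using (¬_; Dec; ¬?)

subsets : ∀ n → List (Subset n)
subsets zero    = [ [] ]
subsets (suc n) = map (inside ∷_) (subsets n) ++ map (outside ∷_) (subsets n)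

sublists : ∀ {A : Set} → List A → List (List A)
sublists []       = [ [] ]
sublists (x ∷ xs) = map (x ∷_) (sublists xs) ++ sublists xs

-- The ground set {1,…,n} is modelled by Fin n.
V : ∀ n → List (Subset n)
V n = filter (λ p → card p ≟ℕ 3) (subsets n)

Adj : ∀ {n} → Subset n → Subset n → Set
Adj p q = card (p ∩ q) ≡ 1

adj? : ∀ {n} (p q : Subset n) → Dec (Adj p q)
adj? p q = card (p ∩ q) ≟ℕ 1

-- V n has no repetitions, so each set W ⊆ V_n occurs exactly once among
-- these lists, listed without repetitions; hence |W| is its length.
vertexSets : ∀ n → List (List (Subset n))
vertexSets n = sublists (V n)

Independent : ∀ {n} → List (Subset n) → Set
Independent = AllPairs (λ p q → ¬ Adj p q)

independent? : ∀ {n} (W : List (Subset n)) → Dec (Independent W)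
independent? = allPairs? (λ p q → ¬? (adj? p q))

α : ℕ → ℕ
α n = max 0 (map length (filter independent? (vertexSets n)))

-- r(W): each unordered pair of vertices of W is inspected once.
edges : ∀ {n} → List (Subset n) → ℕ
edges []      = 0
edges (p ∷ W) = length (filter (adj? p) W) ℕ.+ edges W

-- r(l) in G(n,3,1).  The first argument of min is an upper bound for every
-- r(W), so it only matters when l > C(n,3) and no W with |W| = l exists.
r : (n l : ℕ) → ℕ
r n l = min (edges (V n)) (map edges (filter (λ W → length W ≟ℕ l) (vertexSets n)))

fromℕ : ℕ → ℚ
fromℕ m = + m / 1

-- The quotient m / d, with the convention m / 0 = 0.
frac : ℕ → ℕ → ℚ
frac m zero    = 0ℚ
frac m (suc d) = + m / suc d

infix 4 _=o_ _∼_

_=o_ : (ℕ → ℚ) → (ℕ → ℚ) → Set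
u =o v = ∀ ε → 0ℚ < ε → ∃[ N ] ∀ n → N ℕ.≤ n → ∣ u n ∣ ≤ ε * ∣ v n ∣

-- u ∼ v means u = v + o(v), i.e. u / v → 1 wherever v is eventually non-zero.
_∼_ : (ℕ → ℚ) → (ℕ → ℚ) → Set
u ∼ v = (λ n → u n - v n) =o v

{-# OPTIONS --safe #-}
module Submission where

-- Lower bound (Turán): repeatedly remove a maximal independent set.  Each removal from
-- W costs at least one edge per remaining vertex, and removes at most α = α_n vertices,
-- so l² ≤ 2αr(W) + αl.  Upper bound: for K disjoint pairs {a_i, b_i} and m = n − 2K further
-- points x, two of the triples {a_i, b_i, x} are adjacent iff they have the same x and
-- different i.  Taking l of them row by row gives 2m·r(W) ≤ l², and since l = o(n²) one can
-- let K be an arbitrarily small fraction of n.  Finally α ≤ n, because distinct triples with no intersection of size 1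
-- are orthonormal vectors over F₂.  As n = o(l), both bounds are l²/2α up to a factor 1 + o(1).

open import Defs
open import Algebra using (CommutativeRing)
import Algebra.Properties.CommutativeSemigroup as CommutativeSemigroupProperties
open import Data.Bool using (Bool; true; false; not; _∧_; _xor_)
open import Data.Bool.Properties using (xor-∧-commutativeRing) renaming (_≟_ to _≟ᵇ_)
open import Data.Fin using (Fin; zero; suc; combine; remQuot)
open import Data.Fin.Properties using (injective⇒≤; 2↔Bool; combine-injective; combine-remQuot) renaming (_≟_ to _≟ᶠ_)
open import Data.Fin.Subset using (Subset; inside; outside; _∩_; ⊥; ⁅_⁆) renaming (∣_∣ to card; _∈_ to _∈ₛ_)
open import Data.Fin.Subset.Properties using (∩-idem; ∩-comm; ∩-zeroˡ; ∩-zeroʳ; ∣p∩q∣≤∣p∣; ∣p∩q∣≤∣q∣; ∣⊥∣≡0; ∣⁅x⁆∣≡1; x∈⁅y⁆⇒x≡y; x∈⁅x⁆)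
import Data.Integer as ℤ
import Data.Integer.Properties as ℤ
open import Data.List using (List; []; _∷_; [_]; _++_; map; filter; length; take; allFin; cartesianProductWith)
open import Data.List.Extrema.Nat using (xs≤max; max≤v⁺; min≤xs; argmin-all)
open import Data.List.Membership.Propositional using (_∈_)
open import Data.List.Membership.Propositional.Properties using (∈-++⁺ˡ; ∈-++⁺ʳ; ∈-++⁻; ∈-map⁺; ∈-map⁻; ∈-filter⁺; ∈-filter⁻; ∈-cartesianProductWith⁻)
open import Data.List.Membership.Propositional.Properties.WithK using (unique∧set⇒bag)
import Data.List.Membership.DecPropositional as DecMembership
open import Data.List.Properties using (length-map; length-++; length-take; length-tabulate; length-filter; filter-++; filter-some; filter-none; filter-accept; filter-reject)
open import Data.List.Relation.Binary.BagAndSetEquality using (∼bag⇒↭)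
open import Data.List.Relation.Binary.Permutation.Propositional as ↭ using (_↭_)
open import Data.List.Relation.Binary.Permutation.Propositional.Properties using (↭-length)
open import Data.List.Relation.Binary.Sublist.Heterogeneous.Properties using (length-mono-≤)
open import Data.List.Relation.Binary.Sublist.Propositional using (_⊆_; []; _∷_; _∷ʳ_; ⊆-refl; ⊆-trans)
open import Data.List.Relation.Binary.Sublist.Propositional.Properties using (All-resp-⊆; filter-⊆)
open import Data.List.Relation.Unary.All as All using (All; []; _∷_)
import Data.List.Relation.Unary.All.Properties as Allₚ
open import Data.List.Relation.Unary.AllPairs using (AllPairs; []; _∷_)
open import Data.List.Relation.Unary.Any using (here; any?)
open import Data.List.Relation.Unary.Unique.Propositional using (Unique)
import Data.List.Relation.Unary.Unique.Propositional.Properties as Unique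
open import Data.Nat using (ℕ; zero; suc; pred; _+_; _*_; _∸_; _^_; _≤_; _<_; _⊓_; _⊔_; _/_; _%_; z≤n; s≤s)
open import Data.Nat.Coprimality using (Coprime)
open import Data.Nat.DivMod using (m≡m%n+[m/n]*n; m%n<n; m/n*n≤m; m≥n⇒m/n>0; m<n*o⇒m/o<n)
open import Data.Nat.Properties
open import Data.Nat.Tactic.RingSolver using (solve-∀)
open import Data.Product using (∃-syntax; _×_; _,_; proj₁; proj₂)
open import Data.Rational as ℚ using (mkℚ; toℚᵘ; *<*)
import Data.Rational.Properties as ℚ
open import Data.Rational.Unnormalised as ℚᵘ using (mkℚᵘ; *≤*; _≃_)
import Data.Rational.Unnormalised.Properties as ℚᵘ
open import Data.Sum using (inj₁; inj₂)
open import Data.Vec as Vec using (Vec; []; _∷_; zipWith)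
open import Data.Vec.Properties using (≡-dec; zipWith-++; ++-injective; ∷-injective)
open import Function using (Injective; Inverse; Injection; _∘_; mk⇔)
open import Function.Properties.Inverse using (↔⇒↣; ↔-sym)
open import Relation.Binary.PropositionalEquality using (_≡_; _≢_; refl; sym; trans; cong; cong₂; subst; subst₂; module ≡-Reasoning)
open import Relation.Nullary using (¬_; Dec; yes; no; contradiction)

-- Lists of vertices, α and r

∈-sublists⁺ : ∀ {A : Set} {xs ys : List A} → xs ⊆ ys → xs ∈ sublists ys
∈-sublists⁺ []                = here refl
∈-sublists⁺ {ys = y ∷ ys} (.y ∷ʳ τ) = ∈-++⁺ʳ (map (y ∷_) (sublists ys)) (∈-sublists⁺ τ)
∈-sublists⁺ (refl ∷ τ)        = ∈-++⁺ˡ (∈-map⁺ (_ ∷_) (∈-sublists⁺ τ))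

∈-sublists⁻ : ∀ {A : Set} {xs : List A} ys → xs ∈ sublists ys → xs ⊆ ys
∈-sublists⁻ []       (here refl) = []
∈-sublists⁻ (y ∷ ys) xs∈ with ∈-++⁻ (map (y ∷_) (sublists ys)) xs∈
... | inj₂ xs∈′ = y ∷ʳ ∈-sublists⁻ ys xs∈′
... | inj₁ xs∈′ with ∈-map⁻ (y ∷_) xs∈′
...   | _ , zs∈ , refl = refl ∷ ∈-sublists⁻ ys zs∈

independent⇒length≤α : ∀ {n} {I : List (Subset n)} → I ⊆ V n → Independent I → length I ≤ α n
independent⇒length≤α {n} I⊆V ind =
  All.lookup (xs≤max 0 _) (∈-map⁺ length (∈-filter⁺ independent? (∈-sublists⁺ I⊆V) ind))

α≤⁺ : ∀ n {b} → (∀ {I} → I ⊆ V n → Independent I → length I ≤ b) → α n ≤ b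
α≤⁺ n h = max≤v⁺ z≤n (All.tabulate λ {k} k∈ → bound (∈-map⁻ length k∈))
  where
  bound : ∀ {k} → ∃[ I ] I ∈ filter independent? (vertexSets n) × k ≡ length I → k ≤ _
  bound (I , I∈ , refl) =
    let I∈V , ind = ∈-filter⁻ independent? {xs = vertexSets n} I∈
    in h (∈-sublists⁻ (V n) I∈V) ind

r≤edges : ∀ {n} {W : List (Subset n)} → W ⊆ V n → r n (length W) ≤ edges W
r≤edges {n} {W} W⊆V =
  All.lookup (min≤xs (edges (V n)) _)
    (∈-map⁺ edges (∈-filter⁺ (λ W′ → length W′ ≟ length W) (∈-sublists⁺ W⊆V) refl))

-- The minimum defining `r n l` is either attained at some `W` or equals its default value
-- `edges (V n)`, so both cases have to be supplied.
r-elim : ∀ n l (P : ℕ → Set) → P (edges (V n)) →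
         (∀ {W} → W ⊆ V n → length W ≡ l → P (edges W)) → P (r n l)
r-elim n l P pV pW = argmin-all (λ k → k) {P = P} pV (All.tabulate λ k∈ → attained (∈-map⁻ edges k∈))
  where
  attained : ∀ {k} → ∃[ W ] W ∈ filter (λ W → length W ≟ l) (vertexSets n) × k ≡ edges W → P k
  attained (W , W∈ , refl) =
    let W∈V , eq = ∈-filter⁻ (λ W → length W ≟ l) {xs = vertexSets n} W∈
    in pW (∈-sublists⁻ (V n) W∈V) eq

-- Greedy removal of independent sets and Turán's bound

degree : ∀ {n} → Subset n → List (Subset n) → ℕ
degree p W = length (filter (adj? p) W)

degree-++ : ∀ {n} (p : Subset n) U W → degree p (U ++ W) ≡ degree p U + degree p W
degree-++ p U W = trans (cong length (filter-++ (adj? p) U W)) (length-++ (filter (adj? p) U))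

degree-∷ : ∀ {n} (p x : Subset n) W → degree p (x ∷ W) ≡ degree p [ x ] + degree p W
degree-∷ p x = degree-++ p [ x ]

-- `I` and `W′` partition `W`, but interleaved in its order. The partition is therefore recorded
-- through counts: `length-split` for all vertices, `degree-split` for the neighbours of an
-- arbitrary `p`.
record GreedySplit {n} (W : List (Subset n)) : Set where
  field
    I W′         : List (Subset n)
    I⊆W          : I ⊆ W
    W′⊆W         : W′ ⊆ W
    independent  : Independent I
    degree-split : ∀ p → degree p W ≡ degree p I + degree p W′
    length-split : length W ≡ length I + length W′
    nonempty     : 0 < length W → 0 < length I
    edges-drop   : length W′ + edges W′ ≤ edges W

-- I is a maximal independent set, so every vertex outside it has a neighbour
-- in it; this accounts for the term length W′ in edges-drop.
greedySplit : ∀ {n} (W : List (Subset n)) → GreedySplit W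
greedySplit [] = record
  { I = [] ; W′ = [] ; I⊆W = [] ; W′⊆W = [] ; independent = [] ; degree-split = λ _ → refl
  ; length-split = refl ; nonempty = λ z → z ; edges-drop = z≤n }
greedySplit (x ∷ W) with greedySplit W
... | S with any? (adj? x) (GreedySplit.I S)
... | yes x~I = record
  { I = I ; W′ = x ∷ W′ ; I⊆W = x ∷ʳ I⊆W ; W′⊆W = refl ∷ W′⊆W ; independent = independent
  ; degree-split = split ; length-split = trans (cong suc length-split) (sym (+-suc _ _))
  ; nonempty = λ _ → <-≤-trans degree>0 (length-filter (adj? x) I)
  -- The neighbour of `x` in `I` supplies the extra edge that pays for the growth of `W′` by one
  -- vertex.
  ; edges-drop = begin
      suc (length W′ + (degree x W′ + edges W′))  ≡⟨ lem (length W′) (degree x W′) (edges W′) ⟩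
      (1 + degree x W′) + (length W′ + edges W′)  ≤⟨ +-mono-≤ (+-monoˡ-≤ (degree x W′) degree>0) edges-drop ⟩
      (degree x I + degree x W′) + edges W        ≡⟨ cong (_+ edges W) (degree-split x) ⟨
      degree x W + edges W                        ∎ }
  where
  open GreedySplit S
  open ≤-Reasoning
  degree>0 : 0 < degree x I
  degree>0 = filter-some (adj? x) x~I
  m+[n+o]≡n+[m+o] : ∀ m n o → m + (n + o) ≡ n + (m + o)
  m+[n+o]≡n+[m+o] = solve-∀
  lem : ∀ a b c → suc (a + (b + c)) ≡ (1 + b) + (a + c)
  lem = solve-∀
  split : ∀ p → degree p (x ∷ W) ≡ degree p I + degree p (x ∷ W′)
  split p rewrite degree-∷ p x W | degree-∷ p x W′ | degree-split p =
    m+[n+o]≡n+[m+o] (degree p [ x ]) (degree p I) (degree p W′)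
... | no ¬x~I = record
  { I = x ∷ I ; W′ = W′ ; I⊆W = refl ∷ I⊆W ; W′⊆W = x ∷ʳ W′⊆W
  ; independent = Allₚ.¬Any⇒All¬ I ¬x~I ∷ independent
  ; degree-split = split ; length-split = cong suc length-split
  ; nonempty = λ _ → s≤s z≤n
  ; edges-drop = ≤-trans edges-drop (m≤n+m (edges W) (degree x W)) }
  where
  open GreedySplit S
  split : ∀ p → degree p (x ∷ W) ≡ degree p (x ∷ I) + degree p W′
  split p rewrite degree-∷ p x W | degree-∷ p x I | degree-split p =
    sym (+-assoc (degree p [ x ]) (degree p I) (degree p W′))

-- One removal: `i` vertices go, `w` stay, and the edges drop from `e` to `e′`. The square grows by
-- `i * (2 * w + i)`, which is at most `a * (2 * w + i)`; the lost edges, at least `w` of them, pay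
-- for `2 * a * w`, and the linear term pays for `a * i`.
turán-step : ∀ {a i w e e′} → i ≤ a → w + e′ ≤ e → w * w ≤ 2 * a * e′ + a * w →
             (i + w) * (i + w) ≤ 2 * a * e + a * (i + w)
turán-step {i = i} {w} {e} {e′} i≤a w+e′≤e ih with m≤n⇒∃[o]m+o≡n i≤a
... | d , refl = begin
  (i + w) * (i + w)                                        ≤⟨ m≤m+n _ _ ⟩
  (i + w) * (i + w) + (2 * w * d + i * d)                  ≡⟨ lem i w d ⟩
  w * w + ((i + d) * w + (i + d) * (i + w))                ≤⟨ +-monoˡ-≤ _ ih ⟩
  (2 * (i + d) * e′ + (i + d) * w) + ((i + d) * w + (i + d) * (i + w))
                                                           ≡⟨ lem′ (i + d) e′ w (i + w) ⟩
  2 * (i + d) * (w + e′) + (i + d) * (i + w)               ≤⟨ +-monoˡ-≤ _ (*-monoʳ-≤ (2 * (i + d)) w+e′≤e) ⟩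
  2 * (i + d) * e + (i + d) * (i + w)                      ∎
  where
  open ≤-Reasoning
  lem : ∀ i w d → (i + w) * (i + w) + (2 * w * d + i * d) ≡ w * w + ((i + d) * w + (i + d) * (i + w))
  lem = solve-∀
  lem′ : ∀ a e w l → (2 * a * e + a * w) + (a * w + a * l) ≡ 2 * a * (w + e) + a * l
  lem′ = solve-∀

turán : ∀ {n} a (W : List (Subset n)) → (∀ {I} → I ⊆ W → Independent I → length I ≤ a) →
        length W * length W ≤ 2 * a * edges W + a * length W
turán {n} a W = go (length W) W ≤-refl
  where
  -- `W′` is shorter than `W` but no subterm of it, so the recursion runs on a bound for the length.
  go : ∀ fuel (W : List (Subset n)) → length W ≤ fuel →
       (∀ {I} → I ⊆ W → Independent I → length I ≤ a) →
       length W * length W ≤ 2 * a * edges W + a * length W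
  go fuel       []        _        _ = z≤n
  go (suc fuel) W@(_ ∷ _) |W|≤fuel h =
    subst (λ k → k * k ≤ 2 * a * edges W + a * k) (sym length-split)
      (turán-step (h I⊆W independent) edges-drop
        (go fuel W′ (≤-pred (≤-trans shorter |W|≤fuel)) λ I⊆ → h (⊆-trans I⊆ W′⊆W)))
    where
    open GreedySplit (greedySplit W)
    shorter : length W′ < length W
    shorter = subst (length W′ <_) (sym length-split) (+-monoˡ-≤ (length W′) (nonempty (s≤s z≤n)))

-- The bound α n ≤ n

-- Addition in F₂ⁿ, a subset being identified with its characteristic vector.
_⊕_ : ∀ {n} → Subset n → Subset n → Subset n
_⊕_ = zipWith _xor_

⊕-cancelˡ : ∀ {n} (u v w : Subset n) → u ⊕ v ≡ u ⊕ w → v ≡ w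
⊕-cancelˡ []          []      []      _  = refl
⊕-cancelˡ (a ∷ u) (b ∷ v) (c ∷ w) eq with ∷-injective eq
... | ab≡ac , eq′ = cong₂ _∷_ (xor-cancelˡ a b c ab≡ac) (⊕-cancelˡ u v w eq′)
  where
  xor-cancelˡ : ∀ a b c → a xor b ≡ a xor c → b ≡ c
  xor-cancelˡ false _     _     e  = e
  xor-cancelˡ true  false false _  = refl
  xor-cancelˡ true  true  true  _  = refl

infix 7 _∙_
-- The standard bilinear form on F₂ⁿ.
_∙_ : ∀ {n} → Subset n → Subset n → Bool
[]      ∙ []      = false
(a ∷ u) ∙ (b ∷ v) = (a ∧ b) xor (u ∙ v)

odd : ℕ → Bool
odd zero    = false
odd (suc n) = not (odd n)

∙-odd : ∀ {n} (u v : Subset n) → u ∙ v ≡ odd (card (u ∩ v))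
∙-odd []          []          = refl
∙-odd (false ∷ u) (_     ∷ v) = ∙-odd u v
∙-odd (true  ∷ u) (false ∷ v) = ∙-odd u v
∙-odd (true  ∷ u) (true  ∷ v) = cong not (∙-odd u v)

open CommutativeSemigroupProperties (CommutativeRing.+-commutativeSemigroup xor-∧-commutativeRing)
  using () renaming (interchange to xor-interchange)

∙-distribʳ-⊕ : ∀ {n} (w u v : Subset n) → w ∙ (u ⊕ v) ≡ (w ∙ u) xor (w ∙ v)
∙-distribʳ-⊕ []          []      []      = refl
∙-distribʳ-⊕ (false ∷ w) (_ ∷ u) (_ ∷ v) = ∙-distribʳ-⊕ w u v
∙-distribʳ-⊕ (true  ∷ w) (a ∷ u) (b ∷ v) =
  trans (cong ((a xor b) xor_) (∙-distribʳ-⊕ w u v)) (xor-interchange a b (w ∙ u) (w ∙ v))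

∙-⊥ : ∀ {n} (w : Subset n) → w ∙ ⊥ ≡ false
∙-⊥ []          = refl
∙-⊥ (true  ∷ w) = ∙-⊥ w
∙-⊥ (false ∷ w) = ∙-⊥ w

-- The linear combination over F₂ of the vectors in `W` with the given coefficients.
subsetSum : ∀ {n} (W : List (Subset n)) → Vec Bool (length W) → Subset n
subsetSum []      []          = ⊥
subsetSum (w ∷ W) (true  ∷ c) = w ⊕ subsetSum W c
subsetSum (w ∷ W) (false ∷ c) = subsetSum W c

subsetSum-orthogonal : ∀ {n} (w : Subset n) {W} → All (λ v → w ∙ v ≡ false) W →
                       ∀ c → w ∙ subsetSum W c ≡ false
subsetSum-orthogonal w []          []          = ∙-⊥ w
subsetSum-orthogonal w (_   ∷ w⊥W) (false ∷ c) = subsetSum-orthogonal w w⊥W c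
subsetSum-orthogonal w {v ∷ W} (w⊥v ∷ w⊥W) (true  ∷ c)
  rewrite ∙-distribʳ-⊕ w v (subsetSum W c) | w⊥v = subsetSum-orthogonal w w⊥W c

-- Orthonormal vectors are linearly independent: pairing a combination with the first vector `w`
-- reads off the coefficient of `w`, because `w` is orthogonal to all later vectors.
subsetSum-injective : ∀ {n} {W : List (Subset n)} → All (λ w → w ∙ w ≡ true) W →
                      AllPairs (λ v w → v ∙ w ≡ false) W → Injective _≡_ _≡_ (subsetSum W)
subsetSum-injective [] [] {[]} {[]} _ = refl
subsetSum-injective {W = w ∷ W} (w∙w ∷ 1s) (w⊥W ∷ 0s) = inj _ _
  where
  true-coefficient : ∀ c → w ∙ (w ⊕ subsetSum W c) ≡ true
  true-coefficient c = trans (∙-distribʳ-⊕ w w _) (cong₂ _xor_ w∙w (subsetSum-orthogonal w w⊥W c))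
  distinct : ∀ c d → w ⊕ subsetSum W c ≢ subsetSum W d
  distinct c d eq
    with trans (sym (true-coefficient c)) (trans (cong (w ∙_) eq) (subsetSum-orthogonal w w⊥W d))
  ... | ()
  inj : ∀ c d → subsetSum (w ∷ W) c ≡ subsetSum (w ∷ W) d → c ≡ d
  inj (true  ∷ c) (true  ∷ d) eq = cong (true ∷_) (subsetSum-injective 1s 0s (⊕-cancelˡ w _ _ eq))
  inj (true  ∷ c) (false ∷ d) eq = contradiction eq (distinct c d)
  inj (false ∷ c) (true  ∷ d) eq = contradiction (sym eq) (distinct d c)
  inj (false ∷ c) (false ∷ d) eq = cong (false ∷_) (subsetSum-injective 1s 0s eq)

fromBool-injective : Injective _≡_ _≡_ (Inverse.from 2↔Bool)
fromBool-injective = Injection.injective (↔⇒↣ (↔-sym 2↔Bool))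

toBool-injective : Injective _≡_ _≡_ (Inverse.to 2↔Bool)
toBool-injective = Injection.injective (↔⇒↣ 2↔Bool)

encode : ∀ {n} → Vec Bool n → Fin (2 ^ n)
encode []      = zero
encode (b ∷ v) = combine (Inverse.from 2↔Bool b) (encode v)

encode-injective : ∀ {n} → Injective _≡_ _≡_ (encode {n})
encode-injective {x = []}    {[]}    _  = refl
encode-injective {x = b ∷ u} {c ∷ v} eq
  with combine-injective (Inverse.from 2↔Bool b) (encode u) (Inverse.from 2↔Bool c) (encode v) eq
... | b≡c , u≡v = cong₂ _∷_ (fromBool-injective b≡c) (encode-injective u≡v)

decode : ∀ n → Fin (2 ^ n) → Vec Bool n
decode zero    _ = []
decode (suc n) i =
  Inverse.to 2↔Bool (proj₁ (remQuot (2 ^ n) i)) ∷ decode n (proj₂ (remQuot {2} (2 ^ n) i))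

decode-injective : ∀ n → Injective _≡_ _≡_ (decode n)
decode-injective zero    {zero} {zero} _ = refl
decode-injective (suc n) {i} {j} eq with ∷-injective eq
... | eq₁ , eq₂ = begin
  i                                             ≡⟨ combine-remQuot {2} (2 ^ n) i ⟨
  combine (proj₁ (rq i)) (proj₂ (rq i))         ≡⟨ cong₂ combine (toBool-injective eq₁) (decode-injective n eq₂) ⟩
  combine (proj₁ (rq j)) (proj₂ (rq j))         ≡⟨ combine-remQuot {2} (2 ^ n) j ⟩
  j                                             ∎
  where
  open ≡-Reasoning
  rq : Fin (2 ^ suc n) → Fin 2 × Fin (2 ^ n)
  rq = remQuot {2} (2 ^ n)

2^-cancel-≤ : ∀ m n → 2 ^ m ≤ 2 ^ n → m ≤ n
2^-cancel-≤ m n 2^m≤2^n with m ≤? n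
... | yes m≤n = m≤n
... | no  m≰n = contradiction 2^m≤2^n (<⇒≱ (^-monoʳ-< 2 (s≤s (s≤s z≤n)) (≰⇒> m≰n)))

-- Counting stands in for dimension: `encode ∘ φ ∘ decode m` embeds `Fin (2 ^ m)` into
-- `Fin (2 ^ n)`.
Vec-Bool-injective⇒≤ : ∀ {m n} {φ : Vec Bool m → Vec Bool n} → Injective _≡_ _≡_ φ → m ≤ n
Vec-Bool-injective⇒≤ {m} {n} φ-inj =
  2^-cancel-≤ m n (injective⇒≤ (decode-injective m ∘ φ-inj ∘ encode-injective))

subsets-unique : ∀ n → Unique (subsets n)
subsets-unique zero    = [] ∷ []
subsets-unique (suc n) =
  Unique.++⁺ (Unique.map⁺ (proj₂ ∘ ∷-injective) (subsets-unique n))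
             (Unique.map⁺ (proj₂ ∘ ∷-injective) (subsets-unique n)) disjoint
  where
  disjoint : ∀ {v} → ¬ (v ∈ map (inside ∷_) (subsets n) × v ∈ map (outside ∷_) (subsets n))
  disjoint (v∈i , v∈o) with ∈-map⁻ (inside ∷_) v∈i | ∈-map⁻ (outside ∷_) v∈o
  ... | _ , _ , refl | _ , _ , ()

V-unique : ∀ n → Unique (V n)
V-unique n = Unique.filter⁺ (λ p → card p ≟ 3) (subsets-unique n)

V-card : ∀ n → All (λ p → card p ≡ 3) (V n)
V-card n = Allₚ.all-filter (λ p → card p ≟ 3) (subsets n)

AllPairs-resp-⊆ : ∀ {A : Set} {R : A → A → Set} {xs ys : List A} →
                  xs ⊆ ys → AllPairs R ys → AllPairs R xs
AllPairs-resp-⊆ []        []         = []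
AllPairs-resp-⊆ (_ ∷ʳ τ)  (_ ∷ rs)   = AllPairs-resp-⊆ τ rs
AllPairs-resp-⊆ (refl ∷ τ) (r ∷ rs)  = All-resp-⊆ τ r ∷ AllPairs-resp-⊆ τ rs

card-∩-full : ∀ {n} (p q : Subset n) → card (p ∩ q) ≡ card p → card (p ∩ q) ≡ card q → p ≡ q
card-∩-full []          []          _ _ = refl
card-∩-full (true  ∷ p) (true  ∷ q) a b = cong (true ∷_) (card-∩-full p q (suc-injective a) (suc-injective b))
card-∩-full (true  ∷ p) (false ∷ q) a b = contradiction a (<⇒≢ (s≤s (∣p∩q∣≤∣p∣ p q)))
card-∩-full (false ∷ p) (true  ∷ q) a b = contradiction b (<⇒≢ (s≤s (∣p∩q∣≤∣q∣ p q)))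
card-∩-full (false ∷ p) (false ∷ q) a b = cong (false ∷_) (card-∩-full p q a b)

-- The intersection has at most three elements. Non-adjacency excludes one and distinctness excludes
-- three, so its size is even.
triples-orthogonal : ∀ {n} {p q : Subset n} → card p ≡ 3 → card q ≡ 3 →
                     p ≢ q → ¬ Adj p q → p ∙ q ≡ false
triples-orthogonal {p = p} {q} |p|≡3 |q|≡3 p≢q ¬p~q = trans (∙-odd p q)
  (even _ refl (subst (card (p ∩ q) ≤_) |p|≡3 (∣p∩q∣≤∣p∣ p q)))
  where
  even : ∀ k → card (p ∩ q) ≡ k → k ≤ 3 → odd k ≡ false
  even 0 _  _ = refl
  even 1 eq _ = contradiction eq ¬p~q
  even 2 _  _ = refl
  even 3 eq _ = contradiction (card-∩-full p q (trans eq (sym |p|≡3)) (trans eq (sym |q|≡3))) p≢q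
  even (suc (suc (suc (suc _)))) _ (s≤s (s≤s (s≤s ())))

independent-orthogonal : ∀ {n} {I : List (Subset n)} → All (λ p → card p ≡ 3) I →
                         Unique I → Independent I →
                         AllPairs (λ v w → v ∙ w ≡ false) I
independent-orthogonal []       []       []       = []
independent-orthogonal (c ∷ cs) (u ∷ us) (i ∷ is) =
  All.zipWith (λ (|q|≡3 , p≢q , ¬p~q) → triples-orthogonal c |q|≡3 p≢q ¬p~q) (cs , All.zip (u , i))
  ∷ independent-orthogonal cs us is

-- The Oddtown argument: sets of odd size with pairwise even intersections are orthonormal over F₂,
-- so their `2 ^ length I` combinations are distinct vectors of F₂ⁿ.
α≤n : ∀ n → α n ≤ n
α≤n n = α≤⁺ n λ {I} I⊆V ind →
  let cs = All-resp-⊆ I⊆V (V-card n) in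
  Vec-Bool-injective⇒≤ (subsetSum-injective (All.map (λ {p} → self p) cs)
    (independent-orthogonal cs (AllPairs-resp-⊆ I⊆V (V-unique n)) ind))
  where
  self : ∀ p → card p ≡ 3 → p ∙ p ≡ true
  self p |p|≡3 rewrite ∙-odd p p | ∩-idem p | |p|≡3 = refl

-- The sparse vertex sets

Adj-sym : ∀ {n} (p q : Subset n) → Adj p q → Adj q p
Adj-sym p q = trans (cong card (∩-comm q p))

degree-singleton-sym : ∀ {n} (p q : Subset n) → degree p [ q ] ≡ degree q [ p ]
degree-singleton-sym p q = go (adj? p q)
  where
  go : Dec (Adj p q) → degree p [ q ] ≡ degree q [ p ]
  go (yes p~q) = trans (cong length (filter-accept (adj? p) p~q))
    (sym (cong length (filter-accept (adj? q) (Adj-sym p q p~q))))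
  go (no ¬p~q) = cong length (trans (filter-reject (adj? p) ¬p~q)
    (sym (filter-reject (adj? q) (¬p~q ∘ Adj-sym q p))))

degree-resp-↭ : ∀ {n} (p : Subset n) {U W} → U ↭ W → degree p U ≡ degree p W
degree-resp-↭ p ↭.refl = refl
degree-resp-↭ p (↭.prep {xs = U} {W} x τ)
  rewrite degree-∷ p x U | degree-∷ p x W = cong (degree p [ x ] +_) (degree-resp-↭ p τ)
degree-resp-↭ p (↭.swap {xs = U} {W} x y τ)
  rewrite degree-∷ p x (y ∷ U) | degree-∷ p y U | degree-∷ p y (x ∷ W) | degree-∷ p x W
        | degree-resp-↭ p τ
  = lem (degree p [ x ]) (degree p [ y ]) (degree p W)
  where
  lem : ∀ a b c → a + (b + c) ≡ b + (a + c)
  lem = solve-∀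
degree-resp-↭ p (↭.trans τ σ) = trans (degree-resp-↭ p τ) (degree-resp-↭ p σ)

-- `edges` tests each pair from its earlier member, so a swap reverses one test and symmetry of
-- adjacency is what keeps the count. This lets the sparse sets be built in an order other than that
-- of `V n`.
edges-resp-↭ : ∀ {n} {U W : List (Subset n)} → U ↭ W → edges U ≡ edges W
edges-resp-↭ ↭.refl = refl
edges-resp-↭ (↭.prep x τ) = cong₂ _+_ (degree-resp-↭ x τ) (edges-resp-↭ τ)
edges-resp-↭ (↭.swap {xs = U} {W} x y τ)
  rewrite degree-∷ x y U | degree-∷ y x W | degree-singleton-sym x y
        | degree-resp-↭ x τ | degree-resp-↭ y τ | edges-resp-↭ τ
  = lem (degree y [ x ]) (degree x W) (degree y W) (edges W)
  where
  lem : ∀ a b c d → (a + b) + (c + d) ≡ (a + c) + (b + d)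
  lem = solve-∀
edges-resp-↭ (↭.trans τ σ) = trans (edges-resp-↭ τ) (edges-resp-↭ σ)

∈-subsets : ∀ {n} (p : Subset n) → p ∈ subsets n
∈-subsets []                  = here refl
∈-subsets (true  ∷ p)         = ∈-++⁺ˡ (∈-map⁺ (inside ∷_) (∈-subsets p))
∈-subsets {suc n} (false ∷ p) = ∈-++⁺ʳ (map (inside ∷_) (subsets n)) (∈-map⁺ (outside ∷_) (∈-subsets p))

∈-V : ∀ {n} {p : Subset n} → card p ≡ 3 → p ∈ V n
∈-V = ∈-filter⁺ (λ p → card p ≟ 3) (∈-subsets _)

-- The members of vertexSets n list their elements in the order of V n.
reorder : ∀ {n} {U : List (Subset n)} → Unique U → All (λ p → card p ≡ 3) U →
          ∃[ W ] W ⊆ V n × W ↭ U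
reorder {n} {U} unique |U|≡3 =
  filter (_∈? U) (V n) , filter-⊆ (_∈? U) (V n) ,
  ∼bag⇒↭ (unique∧set⇒bag (Unique.filter⁺ (_∈? U) (V-unique n)) unique
    (mk⇔ (λ p∈ → proj₂ (∈-filter⁻ (_∈? U) {xs = V n} p∈))
         (λ p∈U → ∈-filter⁺ (_∈? U) (∈-V (All.lookup |U|≡3 p∈U)) p∈U)))
  where open DecMembership (≡-dec {n = n} _≟ᵇ_) using (_∈?_)

card-++ : ∀ {m n} (p : Subset m) (q : Subset n) → card (p Vec.++ q) ≡ card p + card q
card-++ []          q = refl
card-++ (true  ∷ p) q = cong suc (card-++ p q)
card-++ (false ∷ p) q = card-++ p q

card-⁅⁆-∩-≢ : ∀ {n} {i j : Fin n} → i ≢ j → card (⁅ i ⁆ ∩ ⁅ j ⁆) ≡ 0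
card-⁅⁆-∩-≢ {suc n} {zero}  {zero}  i≢j = contradiction refl i≢j
card-⁅⁆-∩-≢ {suc n} {zero}  {suc j} _   = trans (cong card (∩-zeroˡ ⁅ j ⁆)) (∣⊥∣≡0 n)
card-⁅⁆-∩-≢ {suc n} {suc i} {zero}  _   = trans (cong card (∩-zeroʳ ⁅ i ⁆)) (∣⊥∣≡0 n)
card-⁅⁆-∩-≢ {suc n} {suc i} {suc j} i≢j = card-⁅⁆-∩-≢ (i≢j ∘ cong suc)

card-⁅⁆-∩-refl : ∀ {n} (i : Fin n) → card (⁅ i ⁆ ∩ ⁅ i ⁆) ≡ 1
card-⁅⁆-∩-refl i = trans (cong card (∩-idem ⁅ i ⁆)) (∣⁅x⁆∣≡1 i)

⁅⁆-injective : ∀ {n} {i j : Fin n} → ⁅ i ⁆ ≡ ⁅ j ⁆ → i ≡ j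
⁅⁆-injective {i = i} {j} eq = x∈⁅y⁆⇒x≡y j (subst (_ ∈ₛ_) eq (x∈⁅x⁆ i))

-- The grid of triples `{a_i, b_i, x_j}` and its edges

module _ {K m : ℕ} where

  -- Writing the ground set as {a₁,…,a_K} ∪ {b₁,…,b_K} ∪ {x₁,…,x_m}, this is {a_i, b_i, x_j}.
  triple : Fin K → Fin m → Subset (K + (K + m))
  triple i x = ⁅ i ⁆ Vec.++ (⁅ i ⁆ Vec.++ ⁅ x ⁆)

  card-triple : ∀ i x → card (triple i x) ≡ 3
  card-triple i x rewrite card-++ ⁅ i ⁆ (⁅ i ⁆ Vec.++ ⁅ x ⁆) | card-++ ⁅ i ⁆ ⁅ x ⁆
    | ∣⁅x⁆∣≡1 i | ∣⁅x⁆∣≡1 x = refl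

  triple-injective : ∀ {i x j y} → triple i x ≡ triple j y → i ≡ j × x ≡ y
  triple-injective {i} {x} {j} {y} eq with ++-injective ⁅ i ⁆ ⁅ j ⁆ eq
  ... | i≡j , eq′ = ⁅⁆-injective i≡j , ⁅⁆-injective (proj₂ (++-injective ⁅ i ⁆ ⁅ j ⁆ eq′))

  -- The index is encoded in two blocks and so counts twice, the point only once; the adjacency
  -- arguments rest on this parity.
  card-triple-∩ : ∀ i x j y → card (triple i x ∩ triple j y) ≡
                  card (⁅ i ⁆ ∩ ⁅ j ⁆) + (card (⁅ i ⁆ ∩ ⁅ j ⁆) + card (⁅ x ⁆ ∩ ⁅ y ⁆))
  card-triple-∩ i x j y
    rewrite zipWith-++ _∧_ ⁅ i ⁆ (⁅ i ⁆ Vec.++ ⁅ x ⁆) ⁅ j ⁆ (⁅ j ⁆ Vec.++ ⁅ y ⁆)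
          | zipWith-++ _∧_ ⁅ i ⁆ ⁅ x ⁆ ⁅ j ⁆ ⁅ y ⁆
          | card-++ (⁅ i ⁆ ∩ ⁅ j ⁆) ((⁅ i ⁆ ∩ ⁅ j ⁆) Vec.++ (⁅ x ⁆ ∩ ⁅ y ⁆))
          | card-++ (⁅ i ⁆ ∩ ⁅ j ⁆) (⁅ x ⁆ ∩ ⁅ y ⁆) = refl

  triple-¬Adj-row : ∀ i x y → ¬ Adj (triple i x) (triple i y)
  triple-¬Adj-row i x y adj rewrite card-triple-∩ i x i y | card-⁅⁆-∩-refl i with adj
  ... | ()

  triple-¬Adj-≢ : ∀ {i x j y} → x ≢ y → ¬ Adj (triple i x) (triple j y)
  triple-¬Adj-≢ {i} {x} {j} {y} x≢y adj rewrite card-triple-∩ i x j y | card-⁅⁆-∩-≢ x≢y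
    | +-identityʳ (card (⁅ i ⁆ ∩ ⁅ j ⁆)) = even≢1 (card (⁅ i ⁆ ∩ ⁅ j ⁆)) adj
    where
    even≢1 : ∀ k → k + k ≢ 1
    even≢1 (suc k) eq rewrite +-suc k k with eq
    ... | ()

  grid : List (Fin K) → List (Fin m) → List (Subset (K + (K + m)))
  grid = cartesianProductWith triple

  degree-own-row : ∀ i x ys → degree (triple i x) (map (triple i) ys) ≡ 0
  degree-own-row i x ys = cong length (filter-none (adj? (triple i x))
    (Allₚ.map⁺ (All.universal (triple-¬Adj-row i x) ys)))

  degree-row-∌ : ∀ i x j {ys} → All (x ≢_) ys → degree (triple i x) (map (triple j) ys) ≡ 0
  degree-row-∌ i x j x∉ys = cong length (filter-none (adj? (triple i x))
    (Allₚ.map⁺ {f = triple j} (All.map (triple-¬Adj-≢ {i} {x} {j}) x∉ys)))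

  -- Only the triple of row `j` through the same point `x` can be adjacent, and `ys` contains `x` at
  -- most once.
  degree-row-≤1 : ∀ i x j {ys} → Unique ys → degree (triple i x) (map (triple j) ys) ≤ 1
  degree-row-≤1 i x j [] = z≤n
  degree-row-≤1 i x j {y ∷ ys} (y∉ys ∷ unique)
    rewrite degree-∷ (triple i x) (triple j y) (map (triple j) ys) with x ≟ᶠ y
  ... | yes refl rewrite degree-row-∌ i x j y∉ys | +-identityʳ (degree (triple i x) [ triple j x ]) =
    length-filter (adj? (triple i x)) [ triple j x ]
  ... | no  x≢y rewrite degree-row-∌ i x j (x≢y ∷ []) = degree-row-≤1 i x j unique

  degree-grid : ∀ i x js {ys} → Unique ys → degree (triple i x) (grid js ys) ≤ length js
  degree-grid i x []       unique = z≤n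
  degree-grid i x (j ∷ js) {ys} unique rewrite degree-++ (triple i x) (map (triple j) ys) (grid js ys) =
    +-mono-≤ (degree-row-≤1 i x j unique) (degree-grid i x js unique)

  length-grid : ∀ is xs → length (grid is xs) ≡ length is * length xs
  length-grid []       xs = refl
  length-grid (i ∷ is) xs
    rewrite length-++ (map (triple i) xs) {grid is xs} | length-map (triple i) xs | length-grid is xs = refl

  -- Proved together with `edges-partial`: a grid with one more row is a partial row containing all
  -- `m` points, and an empty partial row leaves a grid.
  edges-grid : ∀ is → 2 * m * edges (grid is (allFin m)) ≤ (length is * m) * (length is * m)
  -- A new triple has no neighbour in its own row and at most one in each full row, hence adds at
  -- most `length is` edges. The left side grows by at most `2 * m * length is`, while the square of
  -- the number `t` of triples grows by `2 * t + 1`, and `t` is at least `length is * m`.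
  edges-partial : ∀ i is xs → 2 * m * edges (map (triple i) xs ++ grid is (allFin m))
                  ≤ (length is * m + length xs) * (length is * m + length xs)

  edges-grid []       = ≤-reflexive (*-zeroʳ (2 * m))
  edges-grid (i ∷ is) =
    subst (λ k → 2 * m * edges (grid (i ∷ is) (allFin m)) ≤ k * k)
      (trans (cong (length is * m +_) (length-tabulate {n = m} (λ x → x))) (+-comm (length is * m) m))
      (edges-partial i is (allFin m))

  edges-partial i is [] rewrite +-identityʳ (length is * m) = edges-grid is
  edges-partial i is (x ∷ xs) = begin
    2 * m * (degree t (map (triple i) xs ++ grid is (allFin m)) + e)  ≤⟨ *-monoʳ-≤ (2 * m) (+-monoˡ-≤ e degree≤) ⟩
    2 * m * (length is + e)                                    ≡⟨ lem m (length is) e ⟩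
    2 * m * e + 2 * (length is * m)                            ≤⟨ +-monoˡ-≤ _ (edges-partial i is xs) ⟩
    (length is * m + length xs) * (length is * m + length xs) + 2 * (length is * m)
                                                               ≤⟨ m≤m+n _ _ ⟩
    _ + (1 + 2 * length xs)                                    ≡⟨ lem′ (length is * m) (length xs) ⟩
    (length is * m + suc (length xs)) * (length is * m + suc (length xs)) ∎
    where
    open ≤-Reasoning
    t = triple i x
    e = edges (map (triple i) xs ++ grid is (allFin m))
    degree≤ : degree t (map (triple i) xs ++ grid is (allFin m)) ≤ length is
    degree≤ rewrite degree-++ t (map (triple i) xs) (grid is (allFin m)) | degree-own-row i x xs =
      degree-grid i x is (Unique.allFin⁺ m)
    lem : ∀ m q e → 2 * m * (q + e) ≡ 2 * m * e + 2 * (q * m)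
    lem = solve-∀
    lem′ : ∀ a d → (a + d) * (a + d) + 2 * a + (1 + 2 * d) ≡ (a + suc d) * (a + suc d)
    lem′ = solve-∀

  partial-unique : ∀ {i is xs} → Unique (i ∷ is) → Unique xs →
                   Unique (map (triple i) xs ++ grid is (allFin m))
  partial-unique {i} {is} {xs} (i∉is ∷ is-unique) xs-unique =
    Unique.++⁺ (Unique.map⁺ (proj₂ ∘ triple-injective {i} {_} {i}) xs-unique)
      (Unique.cartesianProductWith⁺ triple triple-injective is-unique (Unique.allFin⁺ m)) disjoint
    where
    disjoint : ∀ {v} → ¬ (v ∈ map (triple i) xs × v ∈ grid is (allFin m))
    disjoint (v∈row , v∈grid)
      with ∈-map⁻ (triple i) v∈row | ∈-cartesianProductWith⁻ triple is (allFin m) v∈grid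
    ... | x , _ , v≡ | j , y , j∈is , _ , v≡′ =
      All.lookup i∉is j∈is (proj₁ (triple-injective (trans (sym v≡) v≡′)))

  partial-card : ∀ i is xs → All (λ p → card p ≡ 3) (map (triple i) xs ++ grid is (allFin m))
  partial-card i is xs = Allₚ.++⁺ (Allₚ.map⁺ (All.universal (card-triple i) xs))
    (All.tabulate λ v∈ → card-grid (∈-cartesianProductWith⁻ triple is (allFin m) v∈))
    where
    card-grid : ∀ {v} → ∃[ j ] ∃[ y ] j ∈ is × y ∈ allFin m × v ≡ triple j y → card v ≡ 3
    card-grid (j , y , _ , _ , refl) = card-triple j y

length-take-allFin : ∀ {k n} → k ≤ n → length (take k (allFin n)) ≡ k
length-take-allFin {k} {n} k≤n =
  trans (length-take k (allFin n))
    (trans (cong (k ⊓_) (length-tabulate {n = n} (λ x → x))) (m≤n⇒m⊓n≡m k≤n))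

Sparse : ℕ → ℕ → ℕ → Set
Sparse n m l = ∃[ W ] W ⊆ V n × length W ≡ l × 2 * m * edges W ≤ l * l

∃-sparse : ∀ K m l → l < K * m → Sparse (K + (K + m)) m l
∃-sparse K zero l l<K*m rewrite *-zeroʳ K with l<K*m
... | ()
∃-sparse K m@(suc _) l l<K*m =
  -- One row beyond the `q` full ones: the head of the list becomes the partial row with `l % m`
  -- triples, possibly none. It exists because `q < K`.
  build (take (suc q) (allFin K)) (length-take-allFin q<K)
    (Unique.take⁺ (suc q) (Unique.allFin⁺ K))
  where
  q = l / m
  q<K : q < K
  q<K = m<n*o⇒m/o<n l<K*m
  xs : List (Fin m)
  xs = take (l % m) (allFin m)
  |xs| : length xs ≡ l % m
  |xs| = length-take-allFin (<⇒≤ (m%n<n l m))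
  build : (is : List (Fin K)) → length is ≡ suc q → Unique is → Sparse (K + (K + m)) m l
  build (i ∷ is) |is| unique
    with W , W⊆V , W↭U ← reorder
      (partial-unique {m = m} unique (Unique.take⁺ (l % m) (Unique.allFin⁺ m)))
      (partial-card i is xs)
    = W , W⊆V , trans (↭-length W↭U) |U| , (begin
      2 * m * edges W                                           ≡⟨ cong (2 * m *_) (edges-resp-↭ W↭U) ⟩
      2 * m * edges U                                           ≤⟨ edges-partial i is xs ⟩
      (length is * m + length xs) * (length is * m + length xs) ≡⟨ cong₂ _*_ l≡ l≡ ⟩
      l * l                                                     ∎)
    where
    open ≤-Reasoning
    U = map (triple i) xs ++ grid is (allFin m)
    l≡ : length is * m + length xs ≡ l
    l≡ rewrite suc-injective |is| | |xs| = trans (+-comm (q * m) (l % m)) (sym (m≡m%n+[m/n]*n l m))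
    |U| : length U ≡ l
    |U| = trans (length-++ (map (triple i) xs)) (trans (cong₂ _+_ (length-map (triple i) xs)
      (trans (length-grid is (allFin m)) (cong (length is *_) (length-tabulate {n = m} (λ x → x)))))
      (trans (+-comm (length xs) _) l≡))

-- Two-sided bounds for r n l

turán-V : ∀ {n} {W : List (Subset n)} → W ⊆ V n →
          length W * length W ≤ 2 * α n * edges W + α n * length W
turán-V {n} {W} W⊆V = turán (α n) W λ I⊆W → independent⇒length≤α (⊆-trans I⊆W W⊆V)

-- The function x² - a x is nondecreasing for x ≥ a. This carries Turán's bound for all of `V n`
-- over to `l`, as the default value in `r n l` requires.
turán-shrink : ∀ {a l L e} → a ≤ l → l ≤ L → L * L ≤ 2 * a * e + a * L →
               l * l ≤ 2 * a * e + a * l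
turán-shrink {a} {l} {e = e} a≤l l≤L h with m≤n⇒∃[o]m+o≡n l≤L
... | d , refl = +-cancelʳ-≤ (a * d) _ _ (begin
  l * l + a * d                 ≤⟨ +-monoʳ-≤ (l * l) (*-monoˡ-≤ d a≤l) ⟩
  l * l + l * d                 ≤⟨ m≤m+n _ _ ⟩
  l * l + l * d + (l + d) * d   ≡⟨ lem l d ⟩
  (l + d) * (l + d)             ≤⟨ h ⟩
  2 * a * e + a * (l + d)       ≡⟨ lem′ (2 * a * e) a l d ⟩
  2 * a * e + a * l + a * d     ∎)
  where
  open ≤-Reasoning
  lem : ∀ l d → l * l + l * d + (l + d) * d ≡ (l + d) * (l + d)
  lem = solve-∀
  lem′ : ∀ x a l d → x + a * (l + d) ≡ x + a * l + a * d
  lem′ = solve-∀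

r-lower : ∀ {n l} → α n ≤ l → l ≤ length (V n) → l * l ≤ 2 * α n * r n l + α n * l
r-lower {n} {l} α≤l l≤|V| = r-elim n l (λ e → l * l ≤ 2 * α n * e + α n * l)
  (turán-shrink {a = α n} {e = edges (V n)} α≤l l≤|V| (turán-V {n} ⊆-refl))
  λ { W⊆V refl → turán-V W⊆V }

-- Choice of the parameters and the resulting estimates

record Split (k n l : ℕ) : Set where
  field
    K m    : ℕ
    total  : K + (K + m) ≡ n
    m-large : k * n ≤ (k + 1) * m
    room   : l < K * m

split : ∀ j n l → let k = suc j in
        2 * (k + 1) ≤ n → k * n ≤ l → 16 * (k + 1) * l ≤ n * n → Split k n l
split j n l c≤n kn≤l 16kl≤nn =
  record { K = K ; m = m ; total = total ; m-large = m-large ; room = room }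
  where
  open ≤-Reasoning
  k = suc j
  c = 2 * (k + 1)
  -- The largest `K` for which the pairs occupy at most the fraction 1/(k + 1) of the ground set.
  K = n / c
  m = n ∸ (K + K)
  Kc≤n : K * c ≤ n
  Kc≤n = m/n*n≤m n c
  total : K + (K + m) ≡ n
  total = trans (sym (+-assoc K K m)) (m+[n∸m]≡n (begin
    K + K             ≤⟨ m≤m+n _ _ ⟩
    K + K + K * (2 * k) ≡⟨ lem K k ⟩
    K * c             ≤⟨ Kc≤n ⟩
    n                 ∎))
    where
    lem : ∀ K k → K + K + K * (2 * k) ≡ K * (2 * (k + 1))
    lem = solve-∀
  m-large : k * n ≤ (k + 1) * m
  m-large = +-cancelˡ-≤ n _ _ (begin
    n + k * n                 ≡⟨ lem n k ⟩
    (k + 1) * n               ≡⟨ cong ((k + 1) *_) total ⟨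
    (k + 1) * (K + (K + m))   ≡⟨ lem′ k K m ⟩
    K * c + (k + 1) * m       ≤⟨ +-monoˡ-≤ _ Kc≤n ⟩
    n + (k + 1) * m           ∎)
    where
    lem : ∀ n k → n + k * n ≡ (k + 1) * n
    lem = solve-∀
    lem′ : ∀ k K m → (k + 1) * (K + (K + m)) ≡ K * (2 * (k + 1)) + (k + 1) * m
    lem′ = solve-∀
  0<K : 0 < K
  0<K = m≥n⇒m/n>0 c≤n
  n≤2m : n ≤ 2 * m
  n≤2m = *-cancelˡ-≤ k (begin
    k * n                ≤⟨ m-large ⟩
    (k + 1) * m          ≤⟨ *-monoˡ-≤ m (+-monoʳ-≤ k (s≤s z≤n)) ⟩
    (k + k) * m          ≡⟨ lem k m ⟩
    k * (2 * m)          ∎)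
    where
    lem : ∀ k m → (k + k) * m ≡ k * (2 * m)
    lem = solve-∀
  -- Since `K` is positive, rounding down in `n / c` loses at most a factor of two.
  n≤2Kc : n ≤ 2 * K * c
  n≤2Kc = begin
    n                ≡⟨ m≡m%n+[m/n]*n n c ⟩
    n % c + K * c    ≤⟨ +-monoˡ-≤ (K * c) (<⇒≤ (m%n<n n c)) ⟩
    c + K * c        ≡⟨ cong (_+ K * c) (*-identityˡ c) ⟨
    1 * c + K * c    ≤⟨ +-monoˡ-≤ (K * c) (*-monoˡ-≤ c 0<K) ⟩
    K * c + K * c    ≡⟨ lem K c ⟩
    2 * K * c        ∎
    where
    lem : ∀ K c → K * c + K * c ≡ 2 * K * c
    lem = solve-∀
  -- Multiplying `n≤2Kc` by `n≤2m` gives the factor 8; the further 2 in the constant 16 makes `room`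
  -- strict, as `l` is positive.
  2l≤Km : 2 * l ≤ K * m
  2l≤Km = *-cancelˡ-≤ (8 * (k + 1)) (begin
    8 * (k + 1) * (2 * l)     ≡⟨ lem k l ⟩
    16 * (k + 1) * l          ≤⟨ 16kl≤nn ⟩
    n * n                     ≤⟨ *-mono-≤ n≤2Kc n≤2m ⟩
    2 * K * c * (2 * m)       ≡⟨ lem′ K k m ⟩
    8 * (k + 1) * (K * m)     ∎)
    where
    lem : ∀ k l → 8 * (k + 1) * (2 * l) ≡ 16 * (k + 1) * l
    lem = solve-∀
    lem′ : ∀ K k m → 2 * K * (2 * (k + 1)) * (2 * m) ≡ 8 * (k + 1) * (K * m)
    lem′ = solve-∀
  0<l : 0 < l
  0<l = <-≤-trans (<-≤-trans (s≤s z≤n) c≤n) (≤-trans (m≤m+n n (j * n)) kn≤l)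
  room : l < K * m
  room = <-≤-trans (m<m+n l 0<l)
    (≤-trans (≤-reflexive (cong (l +_) (sym (+-identityʳ l)))) 2l≤Km)

-- Both directions have relative error 1/k. Below, Turán's error term `α n * l` is at most l²/k
-- because `k * α n ≤ k * n ≤ l`. Above, `α n ≤ n` and `m-large` compare `k * α n` with
-- `(k + 1) * m`, and the sparse set does the rest.
r-bounds : ∀ j n l → let k = suc j in 2 * (k + 1) ≤ n → k * n ≤ l → 16 * (k + 1) * l ≤ n * n →
           0 < α n ×
           k * (l * l) ≤ k * (2 * α n * r n l) + l * l ×
           k * (2 * α n * r n l) ≤ k * (l * l) + l * l
r-bounds j n l c≤n kn≤l 16kl≤nn with split j n l c≤n kn≤l 16kl≤nn
... | record { K = K ; m = m ; total = refl ; m-large = m-large ; room = room }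
  with ∃-sparse K m l room
...   | W , W⊆V , refl , sparse = α>0 , lower , upper
  where
  open ≤-Reasoning
  k = suc j
  a = α n
  R = r n l
  n≤l : n ≤ l
  n≤l = ≤-trans (m≤m+n n (j * n)) kn≤l
  -- With `α n` equal to 0, Turán's bound would force `l * l ≤ 0`.
  α>0 : 0 < a
  α>0 = n≢0⇒n>0 λ a≡0 → contradiction
    (subst (λ a → l * l ≤ 2 * a * edges W + a * l) a≡0 (turán-V W⊆V))
    (<⇒≱ (*-mono-< 0<l 0<l))
    where
    0<l : 0 < l
    0<l = <-≤-trans (<-≤-trans (s≤s z≤n) c≤n) n≤l
  lower : k * (l * l) ≤ k * (2 * a * R) + l * l
  lower = begin
    -- The sparse set `W` also witnesses that `l` does not exceed the number of vertices.
    k * (l * l)                       ≤⟨ *-monoʳ-≤ k (r-lower {n} (≤-trans (α≤n n) n≤l) (length-mono-≤ W⊆V)) ⟩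
    k * (2 * a * R + a * l)           ≡⟨ lem k (2 * a * R) a l ⟩
    k * (2 * a * R) + k * a * l       ≤⟨ +-monoʳ-≤ (k * (2 * a * R)) (*-monoˡ-≤ l kα≤l) ⟩
    k * (2 * a * R) + l * l           ∎
    where
    kα≤l : k * a ≤ l
    kα≤l = ≤-trans (*-monoʳ-≤ k (α≤n n)) kn≤l
    lem : ∀ k x a l → k * (x + a * l) ≡ k * x + k * a * l
    lem = solve-∀
  upper : k * (2 * a * R) ≤ k * (l * l) + l * l
  upper = begin
    k * (2 * a * R)                   ≤⟨ *-monoʳ-≤ k (*-mono-≤ (*-monoʳ-≤ 2 (α≤n n)) (r≤edges W⊆V)) ⟩
    k * (2 * n * edges W)             ≡⟨ lem k n (edges W) ⟩
    k * n * (2 * edges W)             ≤⟨ *-monoˡ-≤ (2 * edges W) m-large ⟩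
    (k + 1) * m * (2 * edges W)       ≡⟨ lem′ k m (edges W) ⟩
    (k + 1) * (2 * m * edges W)       ≤⟨ *-monoʳ-≤ (k + 1) sparse ⟩
    (k + 1) * (l * l)                 ≡⟨ lem″ k (l * l) ⟩
    k * (l * l) + l * l               ∎
    where
    lem : ∀ k n e → k * (2 * n * e) ≡ k * n * (2 * e)
    lem = solve-∀
    lem′ : ∀ k m e → (k + 1) * m * (2 * e) ≡ (k + 1) * (2 * m * e)
    lem′ = solve-∀
    lem″ : ∀ k x → (k + 1) * x ≡ k * x + x
    lem″ = solve-∀

-- Passing to rational numbers

open import Data.Integer using (+_; -[1+_]; _⊖_)

-- In unnormalised form numerators and denominators are explicit, so comparisons of rationals become
-- integer inequalities by cross-multiplication.
toℚᵘ-fromℕ : ∀ m → toℚᵘ (fromℕ m) ≃ mkℚᵘ (+ m) 0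
toℚᵘ-fromℕ m = ℚ.toℚᵘ-fromℚᵘ (mkℚᵘ (+ m) 0)

toℚᵘ-frac : ∀ m d → toℚᵘ (frac m (suc d)) ≃ mkℚᵘ (+ m) d
toℚᵘ-frac m d = ℚ.toℚᵘ-fromℚᵘ (mkℚᵘ (+ m) d)

toℚᵘ-∣-∣ : ∀ {p q} → toℚᵘ p ≃ q → toℚᵘ ℚ.∣ p ∣ ≃ ℚᵘ.∣ q ∣
toℚᵘ-∣-∣ {p} p≃q = ℚᵘ.≃-trans (ℚ.toℚᵘ-homo-∣-∣ p) (ℚᵘ.∣-∣-cong p≃q)

toℚᵘ-* : ∀ {p q p′ q′} → toℚᵘ p ≃ p′ → toℚᵘ q ≃ q′ → toℚᵘ (p ℚ.* q) ≃ p′ ℚᵘ.* q′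
toℚᵘ-* {p} {q} e f = ℚᵘ.≃-trans (ℚ.toℚᵘ-homo-* p q) (ℚᵘ.*-cong e f)

toℚᵘ-- : ∀ {p q p′ q′} → toℚᵘ p ≃ p′ → toℚᵘ q ≃ q′ → toℚᵘ (p ℚ.- q) ≃ p′ ℚᵘ.- q′
toℚᵘ-- {p} {q} e f = ℚᵘ.≃-trans (ℚ.toℚᵘ-homo-+ p (ℚ.- q))
  (ℚᵘ.+-cong e (ℚᵘ.≃-trans (ℚ.toℚᵘ-homo‿- q) (ℚᵘ.-‿cong f)))

∣fromℕ∣≤1/k*⇒*≤ : ∀ j a b → ℚ.∣ fromℕ a ∣ ℚ.≤ frac 1 (suc j) ℚ.* ℚ.∣ fromℕ b ∣ → suc j * a ≤ b
∣fromℕ∣≤1/k*⇒*≤ j a b h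
  with ℚᵘ.≤-respʳ-≃ (toℚᵘ-* {frac 1 (suc j)} (toℚᵘ-frac 1 j) (toℚᵘ-∣-∣ {fromℕ b} (toℚᵘ-fromℕ b)))
        (ℚᵘ.≤-respˡ-≃ (toℚᵘ-∣-∣ {fromℕ a} (toℚᵘ-fromℕ a)) (ℚ.toℚᵘ-mono-≤ h))
... | *≤* le = subst₂ _≤_ (lem a (suc j)) (lem′ b) (ℤ.drop‿+≤+ (subst₂ ℤ._≤_
       (sym (ℤ.pos-* a (suc j * 1)))
       (trans (cong (ℤ._* + 1) (sym (ℤ.pos-* 1 b))) (sym (ℤ.pos-* (1 * b) 1))) le))
  where
  lem : ∀ a k → a * (k * 1) ≡ k * a
  lem = solve-∀
  lem′ : ∀ b → 1 * b * 1 ≡ b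
  lem′ = solve-∀

∣⊖∣*k≤n : ∀ k m n → k * n ≤ k * m + n → k * m ≤ k * n + n → ℤ.∣ m ⊖ n ∣ * k ≤ n
∣⊖∣*k≤n k m n kn≤km+n km≤kn+n with ≤-total m n
... | inj₁ m≤n rewrite ℤ.∣⊖∣-≤ m≤n | *-comm (n ∸ m) k | *-distribˡ-∸ k n m =
  m≤n+o⇒m∸n≤o (k * n) (k * m) kn≤km+n
... | inj₂ n≤m rewrite ℤ.∣m⊖n∣≡∣n⊖m∣ m n | ℤ.∣⊖∣-≤ n≤m | *-comm (m ∸ n) k | *-distribˡ-∸ k m n =
  m≤n+o⇒m∸n≤o (k * m) (k * n) km≤kn+n

-- With denominators cleared, the two hypotheses give `suc j * |suc d * R − L| ≤ L`. This is the
-- bound for 1/(j + 1), and the numerator `suc p` only enlarges the right side.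
relative-error : ∀ p j .(c : Coprime (suc p) (suc j)) R L d →
  suc j * L ≤ suc j * (suc d * R) + L → suc j * (suc d * R) ≤ suc j * L + L →
  ℚ.∣ fromℕ R ℚ.- frac L (suc d) ∣ ℚ.≤ mkℚ (+ suc p) j c ℚ.* ℚ.∣ frac L (suc d) ∣
relative-error p j c R L d lower upper = ℚ.toℚᵘ-cancel-≤
  (ℚᵘ.≤-respˡ-≃ (ℚᵘ.≃-sym (toℚᵘ-∣-∣ {fromℕ R ℚ.- frac L (suc d)}
    (toℚᵘ-- {fromℕ R} (toℚᵘ-fromℕ R) (toℚᵘ-frac L d))))
  (ℚᵘ.≤-respʳ-≃ (ℚᵘ.≃-sym (toℚᵘ-* {mkℚ (+ suc p) j c} ℚᵘ.≃-refl
    (toℚᵘ-∣-∣ {frac L (suc d)} (toℚᵘ-frac L d))))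
  (*≤* (subst₂ ℤ._≤_ (ℤ.pos-* A (suc j * suc d)) rhs (ℤ.+≤+ bound)))))
  where
  A = ℤ.∣ + R ℤ.* + suc d ℤ.+ (ℤ.- (+ L)) ℤ.* + 1 ∣
  A≡ : A ≡ ℤ.∣ suc d * R ⊖ L ∣
  A≡ = cong ℤ.∣_∣ (trans (cong₂ ℤ._+_
         (trans (sym (ℤ.pos-* R (suc d))) (cong +_ (*-comm R (suc d))))
         (ℤ.*-identityʳ (ℤ.- (+ L))))
         (ℤ.m-n≡m⊖n (suc d * R) L))
  rhs : + (suc p * L * (1 * suc d)) ≡ + suc p ℤ.* + L ℤ.* + (1 * suc d)
  rhs = trans (ℤ.pos-* (suc p * L) (1 * suc d)) (cong (ℤ._* + (1 * suc d)) (ℤ.pos-* (suc p) L))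
  bound : A * (suc j * suc d) ≤ suc p * L * (1 * suc d)
  bound rewrite sym (*-assoc A (suc j) (suc d)) | *-identityˡ (suc d) | A≡ = *-monoˡ-≤ (suc d)
    (≤-trans (∣⊖∣*k≤n (suc j) (suc d * R) L lower upper) (m≤m+n L (p * L)))

=o⇒eventually-*≤ : ∀ (u v : ℕ → ℕ) → (λ n → fromℕ (u n)) =o (λ n → fromℕ (v n)) →
                   ∀ j → ∃[ N ] ∀ n → N ≤ n → suc j * u n ≤ v n
=o⇒eventually-*≤ u v u=ov j
  with u=ov (frac 1 (suc j)) (ℚ.positive⁻¹ (frac 1 (suc j)) {{ℚ.normalize-pos 1 (suc j)}})
... | N , h = N , λ n N≤n → ∣fromℕ∣≤1/k*⇒*≤ j (u n) (v n) (h n N≤n)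

frac-relative-error : ∀ p j .(c : Coprime (suc p) (suc j)) R l a → 0 < a → let k = suc j in
  k * (l * l) ≤ k * (2 * a * R) + l * l → k * (2 * a * R) ≤ k * (l * l) + l * l →
  ℚ.∣ fromℕ R ℚ.- frac (l ^ 2) (2 * a) ∣ ℚ.≤ mkℚ (+ suc p) j c ℚ.* ℚ.∣ frac (l ^ 2) (2 * a) ∣
frac-relative-error p j c R l (suc a) _ lower upper rewrite *-identityʳ l =
  -- `a + suc (a + 0)` is the predecessor of `2 * suc a`.
  relative-error p j c R (l * l) (a + suc (a + 0)) lower upper

r-relative-error : ∀ p j .(c : Coprime (suc p) (suc j)) n l → let k = suc j in
  2 * (k + 1) ≤ n → k * n ≤ l → 16 * (k + 1) * l ≤ n ^ 2 →
  ℚ.∣ fromℕ (r n l) ℚ.- frac (l ^ 2) (2 * α n) ∣ ℚ.≤ mkℚ (+ suc p) j c ℚ.* ℚ.∣ frac (l ^ 2) (2 * α n) ∣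
r-relative-error p j c n l c≤n kn≤l 16kl≤n² =
  let α>0 , lower , upper = r-bounds j n l c≤n kn≤l
        (subst (16 * (suc j + 1) * l ≤_) (cong (n *_) (*-identityʳ n)) 16kl≤n²)
  in frac-relative-error p j c (r n l) l (α n) α>0 lower upper

theorem1 : (f g l : ℕ → ℕ) →
    (λ n → fromℕ n) =o (λ n → fromℕ (f n)) →
    (λ n → fromℕ (g n)) =o (λ n → fromℕ (n ^ 2)) →
    (∀ n → f n ≤ l n) →
    (∀ n → l n ≤ g n) →
    (λ n → fromℕ (r n (l n))) ∼ (λ n → frac (l n ^ 2) (2 * α n))
theorem1 f g l n=of g=on² f≤l l≤g (mkℚ (+ zero) _ _) (*<* (ℤ.+<+ ()))
theorem1 f g l n=of g=on² f≤l l≤g (mkℚ -[1+ _ ] _ _) (*<* ())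
-- Here ε = (p + 1)/(j + 1) is at least 1/k for `k = suc j`, so precision 1/k suffices. The
-- thresholds secure a positive `K`, then `k * n ≤ l n`, then `16 * (k + 1) * l n ≤ n ^ 2`.
theorem1 f g l n=of g=on² f≤l l≤g (mkℚ (+ suc p) j c) _ =
  2 * (k + 1) ⊔ (N₁ ⊔ N₂) , λ n N≤n →
  let N′≤n = m⊔n≤o⇒n≤o (2 * (k + 1)) (N₁ ⊔ N₂) N≤n in
  r-relative-error p j c n (l n)
    (m⊔n≤o⇒m≤o (2 * (k + 1)) (N₁ ⊔ N₂) N≤n)
    (≤-trans (proj₂ eventually₁ n (m⊔n≤o⇒m≤o N₁ N₂ N′≤n)) (f≤l n))
    (≤-trans (*-monoʳ-≤ (16 * (k + 1)) (l≤g n)) (proj₂ eventually₂ n (m⊔n≤o⇒n≤o N₁ N₂ N′≤n)))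
  where
  k = suc j
  eventually₁ : ∃[ N ] ∀ n → N ≤ n → k * n ≤ f n
  eventually₁ = =o⇒eventually-*≤ (λ n → n) f n=of j
  eventually₂ : ∃[ N ] ∀ n → N ≤ n → 16 * (k + 1) * g n ≤ n ^ 2
  eventually₂ = =o⇒eventually-*≤ g (_^ 2) g=on² (pred (16 * (k + 1)))
  N₁ = proj₁ eventually₁
  N₂ = proj₁ eventually₂
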